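{- Let $\gamma,\alpha,\lambda$ be umbrae, let $m$ be an integer, and let $n,k$ be integers with $n-k\ge 0$. Then \[ (\gamma+k.\alpha)^{n-k}\simeq\sum_{i=0}^{n-k}\binom{n-k}{i}\big(\gamma+(k-m).\alpha+i.\lambda\big)^{n-k-i}\; m.\alpha\big(m.\alpha+(-i).\lambda\big)^{i-1}, \] equivalently \[ (\gamma+k.\alpha)^{n-k}\simeq(n-k)!\sum_{i=0}^{n-k}\frac{\big(\gamma+(k-m).\alpha+i.\lambda\big)^{n-k-i}}{(n-k-i)!}\;\frac{m.\alpha\big(m.\alpha+(-i).\lambda\big)^{i-1}}{i!}. \]
   Context: Classical umbral calculus (Rota–Taylor). Let $R=\mathbb{C}[x]$ and let $A$ be a saturated alphabet of commuting indeterminates called umbrae; $E:R[A]\to R$ is the $R$-linear "evaluation" with $E[1]=1$ and $E[\alpha^i\beta^j\cdots\gamma^k]=E[\alpha^i]E[\beta^j]\cdots E[\gamma^k]$ for pairwise distinct umbrae (uncorrelation). For umbral polynomials, $p\simeq q$ means $E[p]=E[q]$; $p\equiv q$ means $p^n\simeq q^n$ for all $n\ge0$. The generating function of an umbra $\alpha$ is $f_\alpha(t)=\sum_{n\ge0}E[\alpha^n]t^n/n!$ (with $E[\alpha^0]=1$); saturation means every sequence with first term $1$ is represented by infinitely many distinct umbrae. For $x\in R\cup A$ (in particular any integer, possibly negative) the auxiliary umbra $x.\alpha$ is defined up to similarity by $(x.\alpha)^n\simeq n![t^n](f_\alpha(t))^x$. Convention: distinct auxiliary umbrae written in a formula (e.g.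 $\gamma$, $(k-m).\alpha$, $i.\lambda$, $m.\alpha$, $(-i).\lambda$) are represented by mutually uncorrelated umbrae, while repeated occurrences of the same expression within one factor of the form $\sigma(\sigma+\cdots)^{i-1}$ denote the same umbra; for $i=0$ the factor $\sigma(\sigma+(-0).\lambda)^{ -1}$ is interpreted as $1$. -}

module Defs where

open import Level using (Level)
open import Data.Nat using (ℕ; zero; suc; _∸_; _≤?_)
open import Data.Nat.Combinatorics using (_C_)
open import Data.Integer using (ℤ; +_; -[1+_])
open import Relation.Nullary using (yes; no)
open import Algebra.Bundles using (CommutativeRing)

-- Semantics of classical umbral calculus over a commutative scalar ring R.
-- An umbra is modelled by its moment sequence  n ↦ E[α^n]  (with E[α^0] = 1).
-- Evaluation of a sum of pairwise uncorrelated umbrae is the binomial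
-- convolution of their moment sequences (= n![t^n] of the product of
-- generating functions); auxiliary umbrae x.α are convolution powers.
module Umbral {c ℓ : Level} (R : CommutativeRing c ℓ) where
  open CommutativeRing R

  Seq : Set c
  Seq = ℕ → Carrier

  fromℕ : ℕ → Carrier
  fromℕ zero    = 0#
  fromℕ (suc n) = 1# + fromℕ n

  sumLt : ℕ → (ℕ → Carrier) → Carrier
  sumLt zero    f = 0#
  sumLt (suc n) f = sumLt n f + f n

  -- moments of α + β for uncorrelated α, β :
  -- E[(α+β)^n] = Σ_{j=0}^{n} C(n,j) E[α^j] E[β^(n-j)]
  conv : Seq → Seq → Seq
  conv a b n = sumLt (suc n) (λ j → fromℕ (n C j) * (a j * b (n ∸ j)))

  unitSeq : Seq
  unitSeq zero    = 1#
  unitSeq (suc n) = 0#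

  natPow : Seq → ℕ → Seq
  natPow a zero    = unitSeq
  natPow a (suc k) = conv a (natPow a k)

  -- moments of the umbra with generating function 1 / f_α(t)
  -- (for a 0 = 1):  b 0 = 1,  b (n+1) = - Σ_{j=1}^{n+1} C(n+1,j) a j b (n+1-j)
  -- invUpTo n is correct at all indices ≤ n
  invUpTo : Seq → ℕ → Seq
  invUpTo a zero    = λ _ → 1#
  invUpTo a (suc n) j with j ≤? n
  ... | yes _ = invUpTo a n j
  ... | no  _ = - sumLt (suc n)
                    (λ i → fromℕ (suc n C suc i) * (a (suc i) * invUpTo a n (n ∸ i)))

  inv : Seq → Seq
  inv a n = invUpTo a n n

  -- moments of x.α for x ∈ ℤ : (x.α)^n ≃ n![t^n] f_α(t)^x
  dot : ℤ → Seq → Seq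
  dot (+ k)      a = natPow a k
  dot -[1+ k ]   a = natPow (inv a) (suc k)

  -- E[ σ (σ + τ)^(i-1) ] for uncorrelated σ, τ with moment sequences s, t;
  -- for i = 0 this factor is interpreted as 1.
  --   σ(σ+τ)^(i-1) = Σ_{j=0}^{i-1} C(i-1,j) σ^(j+1) τ^(i-1-j)
  shiftFactor : Seq → Seq → ℕ → Carrier
  shiftFactor s t zero    = 1#
  shiftFactor s t (suc i) = sumLt (suc i) (λ j → fromℕ (i C j) * (s (suc j) * t (i ∸ j)))

{-# OPTIONS --safe #-}

-- A moment sequence a stands for the series Σ aₙ tⁿ/n!, on which conv is the product and the
-- shift ∂ is a derivation.  Let l = f_λ, u = t l and uᵢ = uⁱ/i!; working with the divided powers
-- uᵢ, for which ∂uᵢ₊₁ = uᵢ ∂u, avoids every division by an integer.  With D = d/du, each series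
-- has the Taylor expansion F = Σ (DⁱF)(0) uᵢ.  Lagrange inversion says that (DⁱF)(0) is
-- cᵢ(F) = (i-1)! [tⁱ⁻¹] (∂F l⁻ⁱ), and it follows from cᵢ₊₁(F) = cᵢ(DF).  For F = f_α^m the number
-- cᵢ(F) is E[m.α (m.α + (-i).λ)ⁱ⁻¹]; multiplying the expansion by f_γ f_α^(k-m) and comparing
-- coefficients gives the theorem.

module Submission where

open import Defs
open import Level using (Level)
open import Data.Nat using (ℕ; zero; suc; _∸_; _≤_; _<_; _≤?_; z≤n; s≤s; s≤s⁻¹)
import Data.Nat as ℕ
import Data.Nat.Properties as ℕₚ
open import Data.Nat.Combinatorics using (_C_; nCk+nC[k+1]≡[n+1]C[k+1]; nC1≡n; k>n⇒nCk≡0)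
open import Data.Integer as ℤ using (ℤ; +_; -[1+_]; ∣_∣; _⊖_)
import Data.Integer.Properties as ℤₚ
open import Data.Product using (_,_)
open import Relation.Nullary using (yes; no; contradiction)
open import Relation.Binary.Structures using (IsEquivalence)
open import Relation.Binary.PropositionalEquality as ≡ using (_≡_)
open import Algebra.Bundles using (CommutativeRing; CommutativeSemiring)
open import Algebra.Structures.Biased using (isCommutativeSemiringˡ)
import Algebra.Solver.Ring.NaturalCoefficients.Default as SemiringSolver
import Relation.Binary.Reasoning.Setoid as SetoidReasoning

module Hurwitz {c ℓ : Level} (R : CommutativeRing c ℓ) where
  open CommutativeRing R hiding (zero)
  open Umbral R
  open SetoidReasoning setoid
  private
    module RS = SemiringSolver commutativeSemiring

  -- Finite sums

  sumLt-cong : ∀ n {f g : ℕ → Carrier} → (∀ j → j < n → f j ≈ g j) → sumLt n f ≈ sumLt n g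
  sumLt-cong zero    f≈g = refl
  sumLt-cong (suc n) f≈g =
    +-cong (sumLt-cong n (λ j j<n → f≈g j (ℕₚ.m≤n⇒m≤1+n j<n))) (f≈g n ℕₚ.≤-refl)

  sumLt-+ : ∀ n f g → sumLt n (λ j → f j + g j) ≈ sumLt n f + sumLt n g
  sumLt-+ zero    f g = sym (+-identityˡ 0#)
  sumLt-+ (suc n) f g = trans (+-congʳ (sumLt-+ n f g))
    (RS.solve 4 (λ a b c d → (a RS.:+ b) RS.:+ (c RS.:+ d) RS.:= (a RS.:+ c) RS.:+ (b RS.:+ d)) refl
      (sumLt n f) (sumLt n g) (f n) (g n))

  sumLt-suc : ∀ n f → sumLt (suc n) f ≈ f 0 + sumLt n (λ j → f (suc j))
  sumLt-suc zero    f = +-comm 0# (f 0)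
  sumLt-suc (suc n) f = trans (+-congʳ (sumLt-suc n f)) (+-assoc _ _ _)

  sumLt-zero : ∀ n {f : ℕ → Carrier} → (∀ j → f j ≈ 0#) → sumLt n f ≈ 0#
  sumLt-zero zero    f≈0 = refl
  sumLt-zero (suc n) f≈0 = trans (+-cong (sumLt-zero n f≈0) (f≈0 n)) (+-identityˡ 0#)

  fromℕ-+ : ∀ m n → fromℕ (m ℕ.+ n) ≈ fromℕ m + fromℕ n
  fromℕ-+ zero    n = sym (+-identityˡ _)
  fromℕ-+ (suc m) n = trans (+-congˡ (fromℕ-+ m n)) (sym (+-assoc _ _ _))

  fromℕ-1 : fromℕ 1 ≈ 1#
  fromℕ-1 = +-identityʳ 1#

  fromℕ-cong : ∀ {m n} → m ≡ n → fromℕ m ≈ fromℕ n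
  fromℕ-cong m≡n = reflexive (≡.cong fromℕ m≡n)

  fromℕ-C-suc : ∀ n j → fromℕ (suc n C suc j) ≈ fromℕ (n C j) + fromℕ (n C suc j)
  fromℕ-C-suc n j =
    trans (fromℕ-cong (≡.sym (nCk+nC[k+1]≡[n+1]C[k+1] n j))) (fromℕ-+ (n C j) (n C suc j))

  -- Subtraction is truncated, so the two indices agree only for `j < n`; in the remaining cases the
  -- binomial coefficient is zero.
  C-shift : ∀ (a : Seq) n j → fromℕ (n C suc j) * a (suc (n ∸ suc j)) ≈ fromℕ (n C suc j) * a (n ∸ j)
  C-shift a n j with suc j ≤? n
  ... | yes j<n = *-congˡ (reflexive (≡.cong a (≡.sym (ℕₚ.+-∸-assoc 1 j<n))))
  ... | no  j≮n = trans (vanishes _) (sym (vanishes _))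
    where
    vanishes : ∀ x → fromℕ (n C suc j) * x ≈ 0#
    vanishes x = trans (*-congʳ (fromℕ-cong (k>n⇒nCk≡0 (ℕₚ.≰⇒> j≮n)))) (zeroˡ x)

  -- The derivation

  ∂ : Seq → Seq
  ∂ a n = a (suc n)

  conv-at-0 : ∀ a b → conv a b 0 ≈ a 0 * b 0
  conv-at-0 a b = trans (+-identityˡ _) (trans (*-congʳ fromℕ-1) (*-identityˡ _))

  -- Pascal's rule splits each term in two. This turns later proofs about `conv` into inductions on
  -- the index: `conv-at-0` starts them and `leibniz` lowers the index.
  leibniz : ∀ a b n → conv a b (suc n) ≈ conv (∂ a) b n + conv a (∂ b) n
  leibniz a b n = begin
    conv a b (suc n)
      ≈⟨ sumLt-suc (suc n) _ ⟩
    x + sumLt (suc n) (λ j → fromℕ (suc n C suc j) * y j)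
      ≈⟨ +-congˡ (trans (sumLt-cong (suc n) (λ j _ → pascal j)) (sumLt-+ (suc n) _ _)) ⟩
    x + (conv (∂ a) b n + sumLt (suc n) (λ j → fromℕ (n C suc j) * y j))
      ≈⟨ RS.solve 3 (λ p q r → p RS.:+ (q RS.:+ r) RS.:= q RS.:+ (p RS.:+ r)) refl x _ _ ⟩
    conv (∂ a) b n + (x + sumLt (suc n) (λ j → fromℕ (n C suc j) * y j))
      ≈⟨ +-congˡ (+-congˡ (sumLt-cong (suc n) (λ j _ → realign j))) ⟩
    conv (∂ a) b n + (x + sumLt (suc n) (λ j → z (suc j)))
      -- `x` is `z 0`, so the sum of `z` has one term more than `conv a (∂ b) n`; that last term
      -- carries the binomial of `n` over `suc n`, which is zero.
      ≈⟨ +-congˡ (sumLt-suc (suc n) z) ⟨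
    conv (∂ a) b n + (conv a (∂ b) n + z (suc n))
      ≈⟨ +-congˡ (trans (+-congˡ z-top) (+-identityʳ _)) ⟩
    conv (∂ a) b n + conv a (∂ b) n ∎
    where
    x = fromℕ 1 * (a 0 * b (suc n))
    y z : ℕ → Carrier
    y j = a (suc j) * b (n ∸ j)
    z j = fromℕ (n C j) * (a j * ∂ b (n ∸ j))
    pascal : ∀ j → fromℕ (suc n C suc j) * y j ≈ fromℕ (n C j) * y j + fromℕ (n C suc j) * y j
    pascal j = trans (*-congʳ (fromℕ-C-suc n j)) (distribʳ _ _ _)
    swap : ∀ p q r → p * (q * r) ≈ q * (p * r)
    swap = RS.solve 3 (λ p q r → p RS.:* (q RS.:* r) RS.:= q RS.:* (p RS.:* r)) refl
    realign : ∀ j → fromℕ (n C suc j) * y j ≈ z (suc j)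
    realign j = trans (swap _ _ _) (trans (*-congˡ (sym (C-shift b n j))) (swap _ _ _))
    z-top : z (suc n) ≈ 0#
    z-top = trans (*-congʳ (fromℕ-cong (k>n⇒nCk≡0 (ℕₚ.n<1+n n)))) (zeroˡ _)

  -- The semiring of Hurwitz series

  infix 4 _≋_
  -- A record rather than a bare function type, so that unification can recover both sequences from
  -- a proof.
  record _≋_ (a b : Seq) : Set ℓ where
    constructor pointwise
    field at : ∀ n → a n ≈ b n
  open _≋_

  infixl 6 _⊞_
  _⊞_ : Seq → Seq → Seq
  (a ⊞ b) n = a n + b n

  zeroSeq : Seq
  zeroSeq _ = 0#

  infixr 7 _⊙_
  _⊙_ : Carrier → Seq → Seq
  (r ⊙ a) n = r * a n

  -- The bound matters: it admits induction hypotheses and truncated expansions that are known only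
  -- up to index `n`.
  conv-cong-≤ : ∀ n {a a′ b b′} → (∀ j → j ≤ n → a j ≈ a′ j) → (∀ j → j ≤ n → b j ≈ b′ j) →
                conv a b n ≈ conv a′ b′ n
  conv-cong-≤ n a≈a′ b≈b′ = sumLt-cong (suc n) (λ j j≤n →
    *-congˡ (*-cong (a≈a′ j (s≤s⁻¹ j≤n)) (b≈b′ (n ∸ j) (ℕₚ.m∸n≤m n j))))

  -- Induction through `leibniz` replaces the reversal of the sum; in `conv-assoc` it likewise
  -- replaces the interchange of a double sum.
  conv-comm : ∀ a b n → conv a b n ≈ conv b a n
  conv-comm a b zero = begin
    conv a b 0 ≈⟨ conv-at-0 a b ⟩
    a 0 * b 0  ≈⟨ *-comm _ _ ⟩
    b 0 * a 0  ≈⟨ conv-at-0 b a ⟨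
    conv b a 0 ∎
  conv-comm a b (suc n) = begin
    conv a b (suc n)                ≈⟨ leibniz a b n ⟩
    conv (∂ a) b n + conv a (∂ b) n ≈⟨ +-cong (conv-comm (∂ a) b n) (conv-comm a (∂ b) n) ⟩
    conv b (∂ a) n + conv (∂ b) a n ≈⟨ +-comm _ _ ⟩
    conv (∂ b) a n + conv b (∂ a) n ≈⟨ leibniz b a n ⟨
    conv b a (suc n)                ∎

  conv-distribʳ : ∀ c a b n → conv (a ⊞ b) c n ≈ conv a c n + conv b c n
  conv-distribʳ c a b n = trans
    (sumLt-cong (suc n) (λ j _ → RS.solve 4
      (λ p x y z → p RS.:* ((x RS.:+ y) RS.:* z) RS.:= p RS.:* (x RS.:* z) RS.:+ p RS.:* (y RS.:* z))
      refl _ _ _ _))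
    (sumLt-+ (suc n) _ _)

  conv-distribˡ : ∀ c a b n → conv c (a ⊞ b) n ≈ conv c a n + conv c b n
  conv-distribˡ c a b n = trans (conv-comm c (a ⊞ b) n)
    (trans (conv-distribʳ c a b n) (+-cong (conv-comm a c n) (conv-comm b c n)))

  conv-assoc : ∀ a b c n → conv (conv a b) c n ≈ conv a (conv b c) n
  conv-assoc a b c zero = begin
    conv (conv a b) c 0 ≈⟨ conv-at-0 (conv a b) c ⟩
    conv a b 0 * c 0    ≈⟨ *-congʳ (conv-at-0 a b) ⟩
    a 0 * b 0 * c 0     ≈⟨ *-assoc _ _ _ ⟩
    a 0 * (b 0 * c 0)   ≈⟨ *-congˡ (conv-at-0 b c) ⟨
    a 0 * conv b c 0    ≈⟨ conv-at-0 a (conv b c) ⟨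
    conv a (conv b c) 0 ∎
  conv-assoc a b c (suc n) = begin
    conv (conv a b) c (suc n)
      ≈⟨ leibniz (conv a b) c n ⟩
    conv (∂ (conv a b)) c n + conv (conv a b) (∂ c) n
      ≈⟨ +-congʳ (conv-cong-≤ n {b = c} (λ j _ → leibniz a b j) (λ _ _ → refl)) ⟩
    conv (conv (∂ a) b ⊞ conv a (∂ b)) c n + conv (conv a b) (∂ c) n
      ≈⟨ +-congʳ (conv-distribʳ c (conv (∂ a) b) (conv a (∂ b)) n) ⟩
    conv (conv (∂ a) b) c n + conv (conv a (∂ b)) c n + conv (conv a b) (∂ c) n
      ≈⟨ +-cong (+-cong (conv-assoc (∂ a) b c n) (conv-assoc a (∂ b) c n)) (conv-assoc a b (∂ c) n) ⟩
    conv (∂ a) (conv b c) n + conv a (conv (∂ b) c) n + conv a (conv b (∂ c)) n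
      ≈⟨ +-assoc _ _ _ ⟩
    conv (∂ a) (conv b c) n + (conv a (conv (∂ b) c) n + conv a (conv b (∂ c)) n)
      ≈⟨ +-congˡ (conv-distribˡ a (conv (∂ b) c) (conv b (∂ c)) n) ⟨
    conv (∂ a) (conv b c) n + conv a (conv (∂ b) c ⊞ conv b (∂ c)) n
      ≈⟨ +-congˡ (conv-cong-≤ n (λ _ _ → refl) (λ j _ → leibniz b c j)) ⟨
    conv (∂ a) (conv b c) n + conv a (∂ (conv b c)) n
      ≈⟨ leibniz a (conv b c) n ⟨
    conv a (conv b c) (suc n) ∎

  conv-zeroˡ : ∀ a n → conv zeroSeq a n ≈ 0#
  conv-zeroˡ a n = sumLt-zero (suc n) (λ _ → trans (*-congˡ (zeroˡ _)) (zeroʳ _))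

  conv-identityˡ : ∀ a n → conv unitSeq a n ≈ a n
  conv-identityˡ a zero    = trans (conv-at-0 unitSeq a) (*-identityˡ _)
  conv-identityˡ a (suc n) = begin
    conv unitSeq a (suc n)                  ≈⟨ leibniz unitSeq a n ⟩
    conv zeroSeq a n + conv unitSeq (∂ a) n ≈⟨ +-cong (conv-zeroˡ a n) (conv-identityˡ (∂ a) n) ⟩
    0# + a (suc n)                          ≈⟨ +-identityˡ _ ⟩
    a (suc n)                               ∎

  conv-⊙ˡ : ∀ r a b n → conv (r ⊙ a) b n ≈ r * conv a b n
  conv-⊙ˡ r a b zero =
    trans (conv-at-0 (r ⊙ a) b) (trans (*-assoc _ _ _) (*-congˡ (sym (conv-at-0 a b))))
  conv-⊙ˡ r a b (suc n) = begin
    conv (r ⊙ a) b (suc n)                      ≈⟨ leibniz (r ⊙ a) b n ⟩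
    conv (r ⊙ ∂ a) b n + conv (r ⊙ a) (∂ b) n   ≈⟨ +-cong (conv-⊙ˡ r (∂ a) b n) (conv-⊙ˡ r a (∂ b) n) ⟩
    r * conv (∂ a) b n + r * conv a (∂ b) n     ≈⟨ distribˡ _ _ _ ⟨
    r * (conv (∂ a) b n + conv a (∂ b) n)       ≈⟨ *-congˡ (leibniz a b n) ⟨
    r * conv a b (suc n)                        ∎

  conv-sumLtˡ : ∀ M (r : ℕ → Carrier) (v : ℕ → Seq) b n →
                conv (λ j → sumLt M (λ i → r i * v i j)) b n ≈ sumLt M (λ i → r i * conv (v i) b n)
  conv-sumLtˡ zero    r v b n = conv-zeroˡ b n
  conv-sumLtˡ (suc M) r v b n = trans
    (conv-distribʳ b (λ j → sumLt M (λ i → r i * v i j)) (r M ⊙ v M) n)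
    (+-cong (conv-sumLtˡ M r v b n) (conv-⊙ˡ (r M) (v M) b n))

  -- Packaging the laws makes the semiring solver available for identities between series.
  hurwitz : CommutativeSemiring c ℓ
  hurwitz = record
    { Carrier = Seq
    ; _≈_ = _≋_
    ; _+_ = _⊞_
    ; _*_ = conv
    ; 0# = zeroSeq
    ; 1# = unitSeq
    ; isCommutativeSemiring = isCommutativeSemiringˡ record
      { +-isCommutativeMonoid = record
        { isMonoid = record
          { isSemigroup = record
            { isMagma = record
              { isEquivalence = ≋-isEquivalence
              ; ∙-cong = λ p q → pointwise λ n → +-cong (at p n) (at q n)
              }
            ; assoc = λ a b c → pointwise λ n → +-assoc (a n) (b n) (c n)
            }
          ; identity = (λ a → pointwise λ n → +-identityˡ (a n))
                     , (λ a → pointwise λ n → +-identityʳ (a n))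
          }
        ; comm = λ a b → pointwise λ n → +-comm (a n) (b n)
        }
      ; *-isCommutativeMonoid = record
        { isMonoid = record
          { isSemigroup = record
            { isMagma = record
              { isEquivalence = ≋-isEquivalence
              ; ∙-cong = λ p q → pointwise λ n → conv-cong-≤ n (λ j _ → at p j) (λ j _ → at q j)
              }
            ; assoc = λ a b c → pointwise (conv-assoc a b c)
            }
          ; identity = (λ a → pointwise (conv-identityˡ a))
                     , (λ a → pointwise λ n → trans (conv-comm a unitSeq n) (conv-identityˡ a n))
          }
        ; comm = λ a b → pointwise (conv-comm a b)
        }
      ; distribʳ = λ c a b → pointwise (conv-distribʳ c a b)
      ; zeroˡ = λ a → pointwise (conv-zeroˡ a)
      }
    }
    where
    ≋-isEquivalence : IsEquivalence _≋_
    ≋-isEquivalence = record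
      { refl  = pointwise λ _ → refl
      ; sym   = λ p → pointwise λ n → sym (at p n)
      ; trans = λ p q → pointwise λ n → trans (at p n) (at q n)
      }

  private
    module H where
      open CommutativeSemiring hurwitz public
      open SetoidReasoning (CommutativeSemiring.setoid hurwitz) public
    module HS = SemiringSolver hurwitz
  open HS using (solve; _:+_; _:*_; _:=_)

  ∂-cong : ∀ {a b} → a ≋ b → ∂ a ≋ ∂ b
  ∂-cong a≋b = pointwise λ n → at a≋b (suc n)

  ∂-conv : ∀ a b → ∂ (conv a b) ≋ conv (∂ a) b ⊞ conv a (∂ b)
  ∂-conv a b = pointwise (leibniz a b)

  -- Natural multiples are written as products with a constant series, so that the solver can treat
  -- them like any other factor.
  const : ℕ → Seq
  const zero    = zeroSeq
  const (suc n) = unitSeq ⊞ const n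

  conv-const : ∀ q a n → conv (const q) a n ≈ fromℕ q * a n
  conv-const zero    a n = trans (conv-zeroˡ a n) (sym (zeroˡ _))
  conv-const (suc q) a n = begin
    conv (unitSeq ⊞ const q) a n          ≈⟨ conv-distribʳ a unitSeq (const q) n ⟩
    conv unitSeq a n + conv (const q) a n ≈⟨ +-cong (conv-identityˡ a n) (conv-const q a n) ⟩
    a n + fromℕ q * a n                   ≈⟨ +-congʳ (*-identityˡ _) ⟨
    1# * a n + fromℕ q * a n              ≈⟨ distribʳ _ _ _ ⟨
    (1# + fromℕ q) * a n                  ∎

  -- Inverses and powers

  -- Raising the bound leaves the entries already determined unchanged, so the values in the
  -- recursion are those of `inv` itself.
  invUpTo-stable : ∀ a n j → j ≤ n → invUpTo a n j ≡ inv a j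
  invUpTo-stable a zero    .zero z≤n = ≡.refl
  invUpTo-stable a (suc n) j j≤1+n with j ≤? n in eq
  ... | yes j≤n = invUpTo-stable a n j j≤n
  ... | no  j≰n with ℕₚ.≤-antisym j≤1+n (ℕₚ.≰⇒> j≰n)
  -- Now `j` is `suc n`, and the right side is stuck on the decision recorded in `eq`; rewriting
  -- lets it reduce to the same sum.
  ...   | ≡.refl rewrite eq = ≡.refl

  inv-suc : ∀ a n → inv a (suc n) ≈ - sumLt (suc n) (λ i → fromℕ (suc n C suc i) * (a (suc i) * inv a (n ∸ i)))
  inv-suc a n with suc n ≤? n
  ... | yes 1+n≤n = contradiction 1+n≤n (ℕₚ.n≮n n)
  ... | no  _     = -‿cong (sumLt-cong (suc n) (λ i _ →
    *-congˡ (*-congˡ (reflexive (invUpTo-stable a n (n ∸ i) (ℕₚ.m∸n≤m n i))))))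

  -- The recursion for `inv` is exactly the vanishing of coefficient `suc n`: the term at index 0 of
  -- the product is the negative of all the others.
  inverseʳ : ∀ {a} → a 0 ≈ 1# → conv a (inv a) ≋ unitSeq
  inverseʳ {a} a₀ = pointwise coeff
    where
    coeff : ∀ n → conv a (inv a) n ≈ unitSeq n
    coeff zero    = trans (conv-at-0 a (inv a)) (trans (*-identityʳ _) a₀)
    coeff (suc n) = begin
      conv a (inv a) (suc n)                    ≈⟨ sumLt-suc (suc n) _ ⟩
      fromℕ 1 * (a 0 * inv a (suc n)) + s       ≈⟨ +-congʳ (*-cong fromℕ-1 (*-congʳ a₀)) ⟩
      1# * (1# * inv a (suc n)) + s             ≈⟨ +-congʳ (trans (*-identityˡ _) (*-identityˡ _)) ⟩
      inv a (suc n) + s                         ≈⟨ +-congʳ (inv-suc a n) ⟩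
      - s + s                                   ≈⟨ -‿inverseˡ s ⟩
      0#                                        ∎
      where
      s = sumLt (suc n) (λ i → fromℕ (suc n C suc i) * (a (suc i) * inv a (n ∸ i)))

  conv-at-0-unital : ∀ {a b} → a 0 ≈ 1# → b 0 ≈ 1# → conv a b 0 ≈ 1#
  conv-at-0-unital {a} {b} a₀ b₀ = trans (conv-at-0 a b) (trans (*-cong a₀ b₀) (*-identityˡ 1#))

  natPow-at-0 : ∀ {a} → a 0 ≈ 1# → ∀ k → natPow a k 0 ≈ 1#
  natPow-at-0 a₀ zero    = refl
  natPow-at-0 {a} a₀ (suc k) = conv-at-0-unital {a} {natPow a k} a₀ (natPow-at-0 {a} a₀ k)

  dot-at-0 : ∀ {a} → a 0 ≈ 1# → ∀ x → dot x a 0 ≈ 1#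
  dot-at-0 a₀ (+ k)    = natPow-at-0 a₀ k
  dot-at-0 a₀ -[1+ k ] = natPow-at-0 refl (suc k)

  natPow-+ : ∀ a m n → natPow a (m ℕ.+ n) ≋ conv (natPow a m) (natPow a n)
  natPow-+ a zero    n = H.sym (H.*-identityˡ _)
  natPow-+ a (suc m) n = H.trans (H.*-congˡ (natPow-+ a m n)) (H.sym (H.*-assoc a (natPow a m) (natPow a n)))

  module _ {a : Seq} (a₀ : a 0 ≈ 1#) where

    -- Each successor cancelled by `_⊖_` corresponds to a factor `conv a (inv a)`, which is the
    -- unit.
    dot-⊖ : ∀ m n → dot (m ⊖ n) a ≋ conv (natPow a m) (natPow (inv a) n)
    dot-⊖ zero    zero    = H.sym (H.*-identityˡ _)
    dot-⊖ zero    (suc n) = H.sym (H.*-identityˡ _)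
    dot-⊖ (suc m) zero    = H.sym (H.*-identityʳ _)
    dot-⊖ (suc m) (suc n) = H.begin
      dot (suc m ⊖ suc n) a
        H.≡⟨ ≡.cong (λ x → dot x a) (ℤₚ.[1+m]⊖[1+n]≡m⊖n m n) ⟩
      dot (m ⊖ n) a
        H.≈⟨ dot-⊖ m n ⟩
      conv A B
        H.≈⟨ H.*-identityˡ _ ⟨
      conv unitSeq (conv A B)
        H.≈⟨ H.*-congʳ {conv A B} (inverseʳ a₀) ⟨
      conv (conv a (inv a)) (conv A B)
        H.≈⟨ solve 4 (λ x y p q → (x :* y) :* (p :* q) := (x :* p) :* (y :* q)) H.refl a (inv a) A B ⟩
      conv (conv a A) (conv (inv a) B) H.∎
      where
      A = natPow a m
      B = natPow (inv a) n

    dot-+ : ∀ x y → dot (x ℤ.+ y) a ≋ conv (dot x a) (dot y a)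
    dot-+ (+ m)    (+ n)    = natPow-+ a m n
    dot-+ (+ m)    -[1+ n ] = dot-⊖ m (suc n)
    dot-+ -[1+ m ] (+ n)    = H.trans (dot-⊖ n (suc m)) (H.*-comm _ _)
    dot-+ -[1+ m ] -[1+ n ] = H.trans
      (H.reflexive (≡.cong (λ k → natPow (inv a) (suc k)) (≡.sym (ℕₚ.+-suc m n))))
      (natPow-+ (inv a) (suc m) (suc n))

  ∂-natPow : ∀ a q → ∂ (natPow a (suc q)) ≋ conv (const (suc q)) (conv (natPow a q) (∂ a))
  ∂-natPow a zero = H.begin
    ∂ (conv a unitSeq)                              H.≈⟨ ∂-cong (H.*-identityʳ a) ⟩
    ∂ a                                             H.≈⟨ H.*-identityˡ _ ⟨
    conv unitSeq (∂ a)                              H.≈⟨ H.*-identityˡ _ ⟨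
    conv unitSeq (conv unitSeq (∂ a))               H.≈⟨ H.*-congʳ {conv unitSeq (∂ a)} (H.+-identityʳ unitSeq) ⟨
    conv (unitSeq ⊞ zeroSeq) (conv unitSeq (∂ a))   H.∎
  ∂-natPow a (suc q) = H.begin
    ∂ (conv a (natPow a (suc q)))
      H.≈⟨ ∂-conv a (natPow a (suc q)) ⟩
    conv (∂ a) (conv a P) ⊞ conv a (∂ (natPow a (suc q)))
      H.≈⟨ H.+-congˡ (H.*-congˡ (∂-natPow a q)) ⟩
    conv (∂ a) (conv a P) ⊞ conv a (conv K (conv P (∂ a)))
      H.≈⟨ solve 4 (λ d x p k → d :* (x :* p) :+ x :* (k :* (p :* d))
                               := (HS.con 1 :+ k) :* ((x :* p) :* d)) H.refl (∂ a) a P K ⟩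
    conv (unitSeq ⊞ K) (conv (conv a P) (∂ a)) H.∎
    where
    P = natPow a q
    K = const (suc q)

  -- Divided powers of t

  -- The series tⁱ/i!, with 1 at index `i` and 0 elsewhere. The recursion makes `∂ (e (suc i))`
  -- equal to `e i` by computation.
  e : ℕ → Seq
  e zero            = unitSeq
  e (suc i) zero    = 0#
  e (suc i) (suc n) = e i n

  -- For `e i` the Leibniz rule becomes Pascal's rule. This is where the binomial coefficients of
  -- the theorem come from.
  conv-e : ∀ i a n → conv (e i) a n ≈ fromℕ (n C i) * a (n ∸ i)
  conv-e zero a n = begin
    conv unitSeq a n ≈⟨ conv-identityˡ a n ⟩
    a n              ≈⟨ *-identityˡ _ ⟨
    1# * a n         ≈⟨ *-congʳ fromℕ-1 ⟨
    fromℕ 1 * a n    ∎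
  conv-e (suc i) a zero    = trans (conv-at-0 (e (suc i)) a) (trans (zeroˡ _) (sym (zeroˡ _)))
  conv-e (suc i) a (suc n) = begin
    conv (e (suc i)) a (suc n)
      ≈⟨ leibniz (e (suc i)) a n ⟩
    conv (e i) a n + conv (e (suc i)) (∂ a) n
      ≈⟨ +-cong (conv-e i a n) (conv-e (suc i) (∂ a) n) ⟩
    fromℕ (n C i) * a (n ∸ i) + fromℕ (n C suc i) * a (suc (n ∸ suc i))
      ≈⟨ +-congˡ (C-shift a n i) ⟩
    fromℕ (n C i) * a (n ∸ i) + fromℕ (n C suc i) * a (n ∸ i)
      ≈⟨ distribʳ _ _ _ ⟨
    (fromℕ (n C i) + fromℕ (n C suc i)) * a (n ∸ i)
      ≈⟨ *-congʳ (fromℕ-C-suc n i) ⟨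
    fromℕ (suc n C suc i) * a (n ∸ i) ∎

  t : Seq
  t = e 1

  conv-t-suc : ∀ a n → conv t a (suc n) ≈ fromℕ (suc n) * a n
  conv-t-suc a n = trans (conv-e 1 a (suc n)) (*-congʳ (fromℕ-cong (nC1≡n (suc n))))

  fromℕ-e : ∀ i n → fromℕ n * e i n ≈ fromℕ i * e i n
  fromℕ-e zero    zero    = refl
  fromℕ-e zero    (suc n) = trans (zeroʳ _) (sym (zeroʳ _))
  fromℕ-e (suc i) zero    = trans (zeroʳ _) (sym (zeroʳ _))
  fromℕ-e (suc i) (suc n) = trans (distribʳ _ _ _) (trans (+-congˡ (fromℕ-e i n)) (sym (distribʳ _ _ _)))

  conv-t-e : ∀ i → conv t (e i) ≋ conv (const (suc i)) (e (suc i))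
  conv-t-e i = pointwise coeff
    where
    coeff : ∀ n → conv t (e i) n ≈ conv (const (suc i)) (e (suc i)) n
    coeff zero = begin
      conv t (e i) 0                   ≈⟨ conv-at-0 t (e i) ⟩
      0# * e i 0                       ≈⟨ zeroˡ _ ⟩
      0#                               ≈⟨ zeroʳ _ ⟨
      fromℕ (suc i) * 0#               ≈⟨ conv-const (suc i) (e (suc i)) 0 ⟨
      conv (const (suc i)) (e (suc i)) 0 ∎
    coeff (suc n) = begin
      conv t (e i) (suc n)               ≈⟨ conv-t-suc (e i) n ⟩
      fromℕ (suc n) * e i n              ≈⟨ fromℕ-e (suc i) (suc n) ⟩
      fromℕ (suc i) * e i n              ≈⟨ conv-const (suc i) (e (suc i)) (suc n) ⟨
      conv (const (suc i)) (e (suc i)) (suc n) ∎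

  -- Lagrange inversion

  module Lagrange {l : Seq} (l₀ : l 0 ≈ 1#) where

    w : Seq
    w = inv l

    u : ℕ → Seq
    u i = conv (e i) (natPow l i)

    -- ∂ (t l), expanded by the product rule
    ∂u : Seq
    ∂u = l ⊞ conv t (∂ l)

    ∂u-at-0 : ∂u 0 ≈ 1#
    ∂u-at-0 = begin
      l 0 + conv t (∂ l) 0 ≈⟨ +-cong l₀ (trans (conv-at-0 t (∂ l)) (zeroˡ _)) ⟩
      1# + 0#              ≈⟨ +-identityʳ 1# ⟩
      1#                   ∎

    -- The factor i+1 produced by differentiating lⁱ⁺¹ is absorbed into `e (suc i)`, where
    -- `conv-t-e` turns it into t times `e i`; then `u i` is a common factor.
    ∂-u : ∀ i → ∂ (u (suc i)) ≋ conv (u i) ∂u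
    ∂-u i = H.begin
      ∂ (conv (e (suc i)) (natPow l (suc i)))
        H.≈⟨ ∂-conv (e (suc i)) (natPow l (suc i)) ⟩
      conv (e i) (conv l P) ⊞ conv (e (suc i)) (∂ (natPow l (suc i)))
        H.≈⟨ H.+-congˡ (H.*-congˡ (∂-natPow l i)) ⟩
      conv (e i) (conv l P) ⊞ conv (e (suc i)) (conv K (conv P (∂ l)))
        H.≈⟨ solve 6 (λ x y l p k d → x :* (l :* p) :+ y :* (k :* (p :* d))
                                     := x :* (l :* p) :+ (k :* y) :* (p :* d))
               H.refl (e i) (e (suc i)) l P K (∂ l) ⟩
      conv (e i) (conv l P) ⊞ conv (conv K (e (suc i))) (conv P (∂ l))
        H.≈⟨ H.+-congˡ (H.*-congʳ {conv P (∂ l)} (conv-t-e i)) ⟨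
      conv (e i) (conv l P) ⊞ conv (conv t (e i)) (conv P (∂ l))
        H.≈⟨ solve 5 (λ x l p t d → x :* (l :* p) :+ (t :* x) :* (p :* d)
                                   := (x :* p) :* (l :+ t :* d))
               H.refl (e i) l P t (∂ l) ⟩
      conv (conv (e i) P) (l ⊞ conv t (∂ l)) H.∎
      where
      P = natPow l i
      K = const (suc i)

    -- Obtained by differentiating l w = 1 and multiplying by w. The derivative of 1/l is written as
    -- a sum equal to zero because the calculus of series is a semiring, without negation.
    ∂-w : ∂ w ⊞ conv (∂ l) (conv w w) ≋ zeroSeq
    ∂-w = H.begin
      ∂ w ⊞ conv (∂ l) (conv w w)
        H.≈⟨ H.+-congʳ (H.*-identityˡ _) ⟨
      conv unitSeq (∂ w) ⊞ conv (∂ l) (conv w w)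
        H.≈⟨ H.+-congʳ (H.*-congʳ {∂ w} (inverseʳ l₀)) ⟨
      conv (conv l w) (∂ w) ⊞ conv (∂ l) (conv w w)
        H.≈⟨ solve 4 (λ l w l′ w′ → (l :* w) :* w′ :+ l′ :* (w :* w) := w :* (l′ :* w :+ l :* w′))
               H.refl l w (∂ l) (∂ w) ⟩
      conv w (conv (∂ l) w ⊞ conv l (∂ w))
        H.≈⟨ H.*-congˡ (∂-conv l w) ⟨
      conv w (∂ (conv l w))
        H.≈⟨ H.*-congˡ (∂-cong (inverseʳ l₀)) ⟩
      conv w zeroSeq
        H.≈⟨ H.zeroʳ w ⟩
      zeroSeq H.∎

    ∂-natPow-w : ∀ p → ∂ (natPow w (suc p)) ⊞ conv (const (suc p)) (conv (∂ l) (natPow w (suc (suc p)))) ≋ zeroSeq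
    ∂-natPow-w p = H.begin
      ∂ (natPow w (suc p)) ⊞ conv K (conv (∂ l) (conv w (conv w P)))
        H.≈⟨ H.+-congʳ (∂-natPow w p) ⟩
      conv K (conv P (∂ w)) ⊞ conv K (conv (∂ l) (conv w (conv w P)))
        H.≈⟨ solve 5 (λ k p w w′ l′ → k :* (p :* w′) :+ k :* (l′ :* (w :* (w :* p)))
                                     := (k :* p) :* (w′ :+ l′ :* (w :* w)))
               H.refl K P w (∂ w) (∂ l) ⟩
      conv (conv K P) (∂ w ⊞ conv (∂ l) (conv w w))
        H.≈⟨ H.*-congˡ ∂-w ⟩
      conv (conv K P) zeroSeq
        H.≈⟨ H.zeroʳ _ ⟩
      zeroSeq H.∎
      where
      P = natPow w p
      K = const (suc p)

    -- Taylor coefficients with respect to u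

    coefficient : Seq → ℕ → Carrier
    coefficient F zero    = F 0
    coefficient F (suc i) = conv (∂ F) (natPow w (suc i)) i

    -- The chain rule dF/du = F′/u′; the division is legitimate since `∂u` has constant term 1.
    D : Seq → Seq
    D F = conv (∂ F) (inv ∂u)

    ∂-D : ∀ F → ∂ F ≋ conv (D F) ∂u
    ∂-D F = H.begin
      ∂ F                                   H.≈⟨ H.*-identityʳ _ ⟨
      conv (∂ F) unitSeq                    H.≈⟨ H.*-congˡ (inverseʳ ∂u-at-0) ⟨
      conv (∂ F) (conv ∂u (inv ∂u))         H.≈⟨ solve 3 (λ x y z → x :* (y :* z) := (x :* z) :* y)
                                                   H.refl (∂ F) ∂u (inv ∂u) ⟩
      conv (conv (∂ F) (inv ∂u)) ∂u         H.∎

    -- The heart of Lagrange's formula: after F′ is replaced by G u′ with G = DF, everything except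
    -- the coefficient of G′ l⁻ⁱ cancels.
    coefficient-D : ∀ F i → coefficient F (suc i) ≈ coefficient (D F) i
    coefficient-D F zero = begin
      conv (∂ F) (natPow w 1) 0 ≈⟨ conv-at-0 (∂ F) (natPow w 1) ⟩
      F 1 * natPow w 1 0        ≈⟨ *-congˡ (natPow-at-0 {w} refl 1) ⟩
      F 1 * 1#                  ≈⟨ conv-at-0 (∂ F) (inv ∂u) ⟨
      D F 0                     ∎
    coefficient-D F (suc p) = begin
      conv (∂ F) (natPow w (suc (suc p))) (suc p)
        ≈⟨ at expand (suc p) ⟩
      conv G W (suc p) + conv t (conv G X) (suc p)
        -- Passing from index `suc p` to `p` differentiates the first product, while in the second
        -- the factor t contributes the multiplier `suc p`.
        ≈⟨ +-cong (leibniz G W p) (conv-t-suc (conv G X) p) ⟩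
      conv (∂ G) W p + conv G (∂ W) p + fromℕ (suc p) * conv G X p
        ≈⟨ +-congˡ (conv-const (suc p) (conv G X) p) ⟨
      conv (∂ G) W p + conv G (∂ W) p + conv K (conv G X) p
        ≈⟨ +-assoc _ _ _ ⟩
      conv (∂ G) W p + (conv G (∂ W) p + conv K (conv G X) p)
        -- The multiplier `suc p` is the exponent of `W`, so the t-term is precisely the negative of
        -- the term containing `∂ W`.
        ≈⟨ +-congˡ (at cancel p) ⟩
      conv (∂ G) W p + 0#
        ≈⟨ +-identityʳ _ ⟩
      conv (∂ G) W p ∎
      where
      G = D F
      W = natPow w (suc p)
      X = conv (∂ l) (conv w W)
      K = const (suc p)
      expand : conv (∂ F) (conv w W) ≋ conv G W ⊞ conv t (conv G X)
      expand = H.begin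
        conv (∂ F) (conv w W)
          H.≈⟨ H.*-congʳ {conv w W} (∂-D F) ⟩
        conv (conv G (l ⊞ conv t (∂ l))) (conv w W)
          -- The summand l of u′ is paired with one factor w so that l w = 1 can remove both.
          H.≈⟨ solve 6 (λ g l t d w v → (g :* (l :+ t :* d)) :* (w :* v)
                                       := (l :* w) :* (g :* v) :+ t :* (g :* (d :* (w :* v))))
                 H.refl G l t (∂ l) w W ⟩
        conv (conv l w) (conv G W) ⊞ conv t (conv G X)
          H.≈⟨ H.+-congʳ (H.trans (H.*-congʳ {conv G W} (inverseʳ l₀)) (H.*-identityˡ _)) ⟩
        conv G W ⊞ conv t (conv G X) H.∎
      cancel : conv G (∂ W) ⊞ conv K (conv G X) ≋ zeroSeq
      cancel = H.begin
        conv G (∂ W) ⊞ conv K (conv G X)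
          H.≈⟨ solve 4 (λ g d k x → g :* d :+ k :* (g :* x) := g :* (d :+ k :* x))
                 H.refl G (∂ W) K X ⟩
        conv G (∂ W ⊞ conv K X)
          H.≈⟨ H.*-congˡ (∂-natPow-w p) ⟩
        conv G zeroSeq
          H.≈⟨ H.zeroʳ G ⟩
        zeroSeq H.∎

    u-suc-at-0 : ∀ i → u (suc i) 0 ≈ 0#
    u-suc-at-0 i = trans (conv-at-0 (e (suc i)) (natPow l (suc i))) (zeroˡ _)

    -- Induction on `M` for all `F` at once: ∂F is DF times u′, the hypothesis expands DF, and
    -- multiplying by u′ turns each `u i` into `∂ (u (suc i))`.
    expansion : ∀ M F j → j < M → F j ≈ sumLt M (λ i → coefficient F i * u i j)
    expansion (suc M) F zero _ = sym (begin
      sumLt (suc M) (λ i → coefficient F i * u i 0)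
        ≈⟨ sumLt-suc M _ ⟩
      F 0 * u 0 0 + sumLt M (λ i → coefficient F (suc i) * u (suc i) 0)
        ≈⟨ +-cong (*-congˡ (conv-at-0-unital {unitSeq} {unitSeq} refl refl))
                  (sumLt-zero M (λ i → trans (*-congˡ (u-suc-at-0 i)) (zeroʳ _))) ⟩
      F 0 * 1# + 0#
        ≈⟨ trans (+-identityʳ _) (*-identityʳ _) ⟩
      F 0 ∎)
    expansion (suc M) F (suc j) (s≤s j<M) = begin
      ∂ F j
        ≈⟨ at (∂-D F) j ⟩
      conv (D F) ∂u j
        -- The product with `∂u` at `j` involves every entry of `D F` up to `j`, hence the statement
        -- for all indices below `M`.
        ≈⟨ conv-cong-≤ j {b = ∂u} (λ k k≤j → expansion M (D F) k (ℕₚ.≤-<-trans k≤j j<M)) (λ _ _ → refl) ⟩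
      conv (λ k → sumLt M (λ i → coefficient (D F) i * u i k)) ∂u j
        ≈⟨ conv-sumLtˡ M (coefficient (D F)) u ∂u j ⟩
      sumLt M (λ i → coefficient (D F) i * conv (u i) ∂u j)
        ≈⟨ sumLt-cong M (λ i _ → *-cong (coefficient-D F i) (at (∂-u i) j)) ⟨
      sumLt M (λ i → coefficient F (suc i) * u (suc i) (suc j))
        ≈⟨ +-identityˡ _ ⟨
      0# + sumLt M (λ i → coefficient F (suc i) * u (suc i) (suc j))
        -- The missing term `i = 0` is restored at no cost: `u 0` is the unit series, zero at
        -- positive indices.
        ≈⟨ +-congʳ (trans (*-congˡ (conv-identityˡ unitSeq (suc j))) (zeroʳ _)) ⟨
      F 0 * u 0 (suc j) + sumLt M (λ i → coefficient F (suc i) * u (suc i) (suc j))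
        ≈⟨ sumLt-suc M _ ⟨
      sumLt (suc M) (λ i → coefficient F i * u i (suc j)) ∎

    conv-expansion : ∀ A F N →
      conv A F N ≈ sumLt (suc N) (λ i → fromℕ (N C i) * (conv A (natPow l i) (N ∸ i) * coefficient F i))
    conv-expansion A F N = begin
      conv A F N
        ≈⟨ conv-comm A F N ⟩
      conv F A N
        -- Only the entries of `F` up to `N` enter, so `suc N` terms of the expansion suffice.
        ≈⟨ conv-cong-≤ N {b = A} (λ j j≤N → expansion (suc N) F j (s≤s j≤N)) (λ _ _ → refl) ⟩
      conv (λ j → sumLt (suc N) (λ i → coefficient F i * u i j)) A N
        ≈⟨ conv-sumLtˡ (suc N) (coefficient F) u A N ⟩
      sumLt (suc N) (λ i → coefficient F i * conv (u i) A N)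
        ≈⟨ sumLt-cong (suc N) (λ i _ → term i) ⟩
      sumLt (suc N) (λ i → fromℕ (N C i) * (conv A (natPow l i) (N ∸ i) * coefficient F i)) ∎
      where
      term : ∀ i → coefficient F i * conv (u i) A N
                   ≈ fromℕ (N C i) * (conv A (natPow l i) (N ∸ i) * coefficient F i)
      term i = begin
        coefficient F i * conv (u i) A N
          ≈⟨ *-congˡ (at (H.trans (H.*-assoc (e i) (natPow l i) A) (H.*-congˡ (H.*-comm (natPow l i) A))) N) ⟩
        coefficient F i * conv (e i) (conv A (natPow l i)) N
          ≈⟨ *-congˡ (conv-e i (conv A (natPow l i)) N) ⟩
        coefficient F i * (fromℕ (N C i) * conv A (natPow l i) (N ∸ i))
          ≈⟨ RS.solve 3 (λ x y z → x RS.:* (y RS.:* z) RS.:= y RS.:* (z RS.:* x)) refl _ _ _ ⟩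
        fromℕ (N C i) * (conv A (natPow l i) (N ∸ i) * coefficient F i) ∎

    -- At `i = 0` the convention that the factor is 1 agrees with the constant term of `F`.
    coefficient-shiftFactor : ∀ {F} → F 0 ≈ 1# → ∀ i → coefficient F i ≈ shiftFactor F (dot (ℤ.- (+ i)) l) i
    coefficient-shiftFactor F₀ zero    = F₀
    -- Both sides compute to one sum: the raised index on `F` is `∂`, and `dot` at `-[1+ i ]` is the
    -- power `suc i` of `inv l`.
    coefficient-shiftFactor F₀ (suc i) = refl

  -- The umbral identity

  umbral-expansion : ∀ (γ : Seq) {α λ′ : Seq} → α 0 ≈ 1# → λ′ 0 ≈ 1# → ∀ m k N →
    conv γ (dot k α) N
      ≈ sumLt (suc N) (λ i →
          fromℕ (N C i)
            * (conv (conv γ (dot (k ℤ.- m) α)) (dot (+ i) λ′) (N ∸ i)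
               * shiftFactor (dot m α) (dot (ℤ.- (+ i)) λ′) i))
  umbral-expansion γ {α} {λ′} α₀ λ₀ m k N = begin
    conv γ (dot k α) N
      -- The exponent `k` is split as (k-m)+m, so that the power `m` is the series to expand and the
      -- rest joins the multiplier `A`.
      ≈⟨ at (H.*-congˡ (H.reflexive (≡.cong (λ x → dot x α) (≡.sym k-m+m≡k)))) N ⟩
    conv γ (dot (k ℤ.- m ℤ.+ m) α) N
      ≈⟨ at (H.trans (H.*-congˡ (dot-+ α₀ (k ℤ.- m) m)) (H.sym (H.*-assoc γ (dot (k ℤ.- m) α) (dot m α)))) N ⟩
    conv A (dot m α) N
      ≈⟨ conv-expansion A (dot m α) N ⟩
    sumLt (suc N) (λ i → fromℕ (N C i) * (conv A (natPow λ′ i) (N ∸ i) * coefficient (dot m α) i))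
      ≈⟨ sumLt-cong (suc N) (λ i _ → *-congˡ (*-congˡ (coefficient-shiftFactor (dot-at-0 α₀ m) i))) ⟩
    sumLt (suc N) (λ i → fromℕ (N C i) * (conv A (natPow λ′ i) (N ∸ i)
                                          * shiftFactor (dot m α) (dot (ℤ.- (+ i)) λ′) i)) ∎
    where
    open Lagrange {λ′} λ₀
    A = conv γ (dot (k ℤ.- m) α)
    k-m+m≡k : k ℤ.- m ℤ.+ m ≡ k
    k-m+m≡k = ≡.trans (ℤₚ.+-assoc k (ℤ.- m) m)
                (≡.trans (≡.cong (λ x → k ℤ.+ x) (ℤₚ.+-inverseˡ m)) (ℤₚ.+-identityʳ k))

theorem3p10 : {c ℓ : Level} (R : CommutativeRing c ℓ) →
    let open CommutativeRing R
        open Umbral R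
    in (γ α λ′ : Seq) → γ 0 ≈ 1# → α 0 ≈ 1# → λ′ 0 ≈ 1# →
       (m n k : ℤ) → + 0 ℤ.≤ n ℤ.- k →
       let N = ∣ n ℤ.- k ∣ in
       conv γ (dot k α) N
         ≈ sumLt (suc N) (λ i →
             fromℕ (N C i)
               * (conv (conv γ (dot (k ℤ.- m) α)) (dot (+ i) λ′) (N ∸ i)
                  * shiftFactor (dot m α) (dot (ℤ.- (+ i)) λ′) i))
theorem3p10 R γ α λ′ _ α₀ λ₀ m n k _ =
  Hurwitz.umbral-expansion R γ α₀ λ₀ m k ∣ n ℤ.- k ∣
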